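{- Let $G=(V,E)$ be a hypergraph and let $(U,\overline U)$ be a minimal balanced minimum $k$-partition split in $G$ for some integer $k\ge2$. Then for every vertex $u_0\in U$ there exists a subset $S\subseteq U\setminus\{u_0\}$ with $|S|\le 2k-3$ such that $(U,\overline U)$ is the unique minimum $(S\cup\{u_0\},\overline U)$-terminal cut in $G$.
   Context: A hypergraph $G=(V,E)$ has finite vertex set $V$ and finite multiset $E$ of unit-cost hyperedges (subsets of $V$). For $X\subseteq V$, $\overline X=V\setminus X$ and $d(X)$ is the number of hyperedges meeting both $X$ and $\overline X$. The cost of an (ordered) partition of $V$ into non-empty parts is the number of hyperedges meeting at least two parts; a minimum $k$-partition is a $k$-partition of minimum cost. A 2-partition $(U,\overline U)$ is a balanced minimum $k$-partition split if there is a minimum $k$-partition $(V_1,\dots,V_k)$ with $U=\bigcup_{i=1}^{\lfloor k/2\rfloor}V_i$; it is minimal if there is no balanced minimum $k$-partition split $(U',\overline{U'})$ with $U'\subsetneq U$. For disjoint $S,T\subseteq V$, a 2-partition $(X,\overline X)$ is an $(S,T)$-terminal cut if $S\subseteq X\subseteq V\setminus T$, and it is minimum if $d(X)$ is minimum among such cuts. -}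

module Defs where

open import Data.Nat.Base using (ℕ; _≤_; ⌊_/2⌋)
open import Data.Nat.Properties using (_<?_)
open import Data.Fin.Base using (Fin; toℕ)
open import Data.Fin.Properties using (_≟_; any?)
open import Data.Fin.Subset using (Subset; Nonempty; Empty; _∈_; _⊆_; _⊂_; _∩_; ∁; ⋃)
open import Data.Fin.Subset.Properties using (nonempty?)
open import Data.List.Base using (List; length; filter; map; allFin)
open import Data.Product.Base using (∃; ∃-syntax; _×_)
open import Relation.Binary.PropositionalEquality.Core using (_≡_; _≢_)
open import Relation.Nullary.Decidable.Core using (Dec; _×-dec_; ¬?)
open import Relation.Nullary.Negation.Core using (¬_)

-- The vertex set is Fin n.  The multiset of hyperedges is a list: everything
-- below depends on it only through counts with multiplicity.
record Hypergraph (n : ℕ) : Set where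
  constructor hypergraph
  field
    edges : List (Subset n)

open Hypergraph public

module _ {n : ℕ} where

  Meets : Subset n → Subset n → Set
  Meets e X = Nonempty (e ∩ X)

  meets? : (e X : Subset n) → Dec (Meets e X)
  meets? e X = nonempty? (e ∩ X)

  Crosses : Subset n → Subset n → Set
  Crosses X e = Meets e X × Meets e (∁ X)

  crosses? : (X e : Subset n) → Dec (Crosses X e)
  crosses? X e = meets? e X ×-dec meets? e (∁ X)

  d : Hypergraph n → Subset n → ℕ
  d G X = length (filter (crosses? X) (edges G))

  -- The 2-partition (X , ∁ X) is represented by X alone.
  Is2Partition : Subset n → Set
  Is2Partition X = Nonempty X × Nonempty (∁ X)

  record IsPartition {k : ℕ} (P : Fin k → Subset n) : Set where
    field
      nonempty : ∀ i → Nonempty (P i)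
      disjoint : ∀ {i j} → i ≢ j → Empty (P i ∩ P j)
      covering : ∀ v → ∃[ i ] v ∈ P i

  MeetsTwoParts : {k : ℕ} → (Fin k → Subset n) → Subset n → Set
  MeetsTwoParts P e = ∃[ i ] ∃[ j ] (i ≢ j × Meets e (P i) × Meets e (P j))

  meetsTwoParts? : {k : ℕ} (P : Fin k → Subset n) (e : Subset n) → Dec (MeetsTwoParts P e)
  meetsTwoParts? P e =
    any? λ i → any? λ j → ¬? (i ≟ j) ×-dec (meets? e (P i) ×-dec meets? e (P j))

  cost : Hypergraph n → {k : ℕ} → (Fin k → Subset n) → ℕ
  cost G P = length (filter (meetsTwoParts? P) (edges G))

  IsMinPartition : Hypergraph n → {k : ℕ} → (Fin k → Subset n) → Set
  IsMinPartition G {k} P =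
    IsPartition P × (∀ (Q : Fin k → Subset n) → IsPartition Q → cost G P ≤ cost G Q)

  -- Fin k is 0-based, so the first ⌊k/2⌋ parts are those with index < ⌊k/2⌋.
  firstHalf : {k : ℕ} → (Fin k → Subset n) → Subset n
  firstHalf {k} P = ⋃ (map P (filter (λ i → toℕ i <? ⌊ k /2⌋) (allFin k)))

  IsBalancedSplit : Hypergraph n → ℕ → Subset n → Set
  IsBalancedSplit G k U =
    Is2Partition U × ∃ λ (P : Fin k → Subset n) → IsMinPartition G P × U ≡ firstHalf P

  IsMinimalBalancedSplit : Hypergraph n → ℕ → Subset n → Set
  IsMinimalBalancedSplit G k U =
    IsBalancedSplit G k U × ¬ (∃[ U′ ] (IsBalancedSplit G k U′ × U′ ⊂ U))

  -- Disjointness of S and T is not required separately: S ⊆ X ⊆ ∁ T implies it.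
  IsTerminalCut : (S T X : Subset n) → Set
  IsTerminalCut S T X = Is2Partition X × S ⊆ X × X ⊆ ∁ T

  IsMinTerminalCut : Hypergraph n → (S T X : Subset n) → Set
  IsMinTerminalCut G S T X =
    IsTerminalCut S T X × (∀ Y → IsTerminalCut S T Y → d G X ≤ d G Y)

  IsUniqueMinTerminalCut : Hypergraph n → (S T X : Subset n) → Set
  IsUniqueMinTerminalCut G S T X =
    IsMinTerminalCut G S T X × (∀ Y → IsMinTerminalCut G S T Y → Y ≡ X)

{-# OPTIONS --safe #-}

-- Let U be a minimal balanced split with a vertex u₀, and let S ⊆ U - u₀ be an
-- inclusion-minimal set for which U is the unique minimum (S ∪ {u₀}, ∁ U)-cut.
-- By minimality, every u ∈ S has a set A u ⊇ ∁ U that meets S ∪ {u₀} only in u,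
-- with d (A u) ≤ d U, and d (A u) minimum among the sets between ∁ U and A u.
--
-- Given A₁, …, Aₘ, write Z for the set of vertices in no Aᵢ, Yᵢ for those in Aᵢ
-- only, and W for those in at least two.  Let Φ count the hyperedges meeting at
-- least two of the classes Y₁, …, Yₘ, W, Z, plus those that meet two of the Yᵢ
-- or both W and Z.  Adding a set A changes Φ by at most d A - d (W ∩ A), which is
-- at most 0 once m ≥ 2, because then ∁ U ⊆ W.  Hence Φ ≤ 2 d U.
--
-- If m = 2 (k - 1), group the classes into two k-partitions: one splits off the
-- first k - 1 of the Yᵢ, the other the last k - 1.  Their costs add up to at most
-- Φ ≤ 2 d U, so one of them costs at most d U, which is at most the minimum cost.
-- Its first ⌊k/2⌋ parts then form a balanced split properly contained in U.
module Submission where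

open import Defs
open import Data.Nat.Base using (ℕ; zero; suc; _+_; _≤_; _<_; _*_; _∸_; z≤n; s≤s; s≤s⁻¹; ⌊_/2⌋)
open import Data.Nat.Properties as ℕ using (≤-refl; ≤-reflexive; ≤-trans; ≤-total; ≰⇒>; +-mono-≤; +-monoˡ-≤; +-monoʳ-≤; +-cancelʳ-≤; m≤m+n; m≤n+m; m≤n+m∸n; +-mono-<; <⇒≱; ⌊n/2⌋<n; _≤?_; _<?_)
open import Data.Nat.Induction using (<-wellFounded)
open import Data.Nat.ListAction using (sum)
open import Data.Nat.Tactic.RingSolver using (solve-∀)
open import Data.Bool.Base using (true; false; if_then_else_)
open import Data.Empty using (⊥)
open import Data.Fin.Base using (Fin; zero; suc; toℕ; fromℕ; inject₁; inject≤; splitAt; _↑ˡ_; _↑ʳ_)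
open import Data.Fin.Properties using (_≟_; any?; suc-injective; toℕ-fromℕ; inject≤-injective; splitAt-↑ˡ; splitAt-↑ʳ)
open import Data.Fin.Relation.Unary.Top using (view; ‵fromℕ; ‵inject₁)
open import Data.Fin.Subset using (Subset; inside; outside; _∈_; _∉_; _⊆_; _⊂_; _∪_; _-_; ⁅_⁆; ∁; ∣_∣; ⋃)
open import Data.Fin.Subset.Properties using (_∈?_; _⊆?_; anySubset?; ∉⊥; x∈p∩q⁺; x∈p∩q⁻; x∈p∪q⁺; x∈p∪q⁻; x∈⁅x⁆; x∈⁅y⁆⇒x≡y; x∈p⇒x∉∁p; x∈∁p⇒x∉p; x∉p⇒x∈∁p; x∉∁p⇒x∈p; x∈p∧x≢y⇒x∈p-y; x∈p⇒p-x⊂p; ⊆-antisym; p─q⊆p)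
open import Data.Fin.Subset.Induction using (⊂-wellFounded)
open import Data.List.Base using (List; []; _∷_; length; filter; map; allFin)
open import Data.List.Membership.Propositional using () renaming (_∈_ to _∈ˡ_)
open import Data.List.Membership.Propositional.Properties using (∈-allFin; ∈-map∘filter⁺; ∈-map∘filter⁻)
open import Data.List.Properties using (length-tabulate)
open import Data.List.Relation.Unary.All as All using (All; []; _∷_)
open import Data.List.Relation.Unary.AllPairs using (_∷_)
open import Data.List.Relation.Unary.Any using (here; there)
open import Data.List.Relation.Unary.Unique.Propositional using (Unique)
open import Data.List.Relation.Unary.Unique.Propositional.Properties using (allFin⁺)
open import Data.Maybe.Base using (Maybe; just; nothing; maybe′)
open import Data.Product.Base using (∃; ∃-syntax; _×_; _,_; proj₁; proj₂)
open import Data.Sum.Base using (_⊎_; inj₁; inj₂; [_,_]′)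
open import Data.Vec.Base using (tabulate; []; _∷_; here; there)
open import Data.Vec.Properties using (lookup∘tabulate; []=⇒lookup; lookup⇒[]=)
open import Function.Base using (_∘_; case_of_)
open import Induction.WellFounded using (Acc; acc)
open import Relation.Binary.PropositionalEquality using (_≡_; _≢_; refl; sym; trans; cong; subst; subst₂)
open import Relation.Nullary using (Dec; yes; no; does; ¬_; ¬?; contradiction; _×-dec_)
open import Relation.Nullary.Decidable using (map′; dec-true; dec-false; decidable-stable)
open import Relation.Unary using (Decidable)

private
  variable
    n m k K : ℕ

-- Subsets

⟦_⟧ : {P : Fin n → Set} → Decidable P → Subset n
⟦ P? ⟧ = tabulate (does ∘ P?)

module _ {P : Fin n → Set} (P? : Decidable P) where

  ∈⟦⟧⁺ : ∀ {v} → P v → v ∈ ⟦ P? ⟧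
  ∈⟦⟧⁺ {v} p = lookup⇒[]= v _ (trans (lookup∘tabulate _ v) (dec-true (P? v) p))

  ∈⟦⟧⁻ : ∀ {v} → v ∈ ⟦ P? ⟧ → P v
  ∈⟦⟧⁻ {v} v∈ with P? v | trans (sym (lookup∘tabulate (does ∘ P?) v)) ([]=⇒lookup v∈)
  ... | yes p | _ = p
  ... | no _  | ()

enumerate : (S : Subset n) → Fin ∣ S ∣ → Fin n
enumerate (outside ∷ S) i       = suc (enumerate S i)
enumerate (inside ∷ S)  zero    = zero
enumerate (inside ∷ S)  (suc i) = suc (enumerate S i)

enumerate-∈ : (S : Subset n) (i : Fin ∣ S ∣) → enumerate S i ∈ S
enumerate-∈ (outside ∷ S) i       = there (enumerate-∈ S i)
enumerate-∈ (inside ∷ S)  zero    = here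
enumerate-∈ (inside ∷ S)  (suc i) = there (enumerate-∈ S i)

enumerate-injective : (S : Subset n) {i j : Fin ∣ S ∣} → enumerate S i ≡ enumerate S j → i ≡ j
enumerate-injective (outside ∷ S) eq = enumerate-injective S (suc-injective eq)
enumerate-injective (inside ∷ S) {zero}  {zero}  eq = refl
enumerate-injective (inside ∷ S) {suc i} {suc j} eq =
  cong suc (enumerate-injective S (suc-injective eq))

∈⋃⁺ : ∀ {v : Fin n} {p ps} → p ∈ˡ ps → v ∈ p → v ∈ ⋃ ps
∈⋃⁺ (here refl) v∈p = x∈p∪q⁺ (inj₁ v∈p)
∈⋃⁺ (there p∈)  v∈p = x∈p∪q⁺ (inj₂ (∈⋃⁺ p∈ v∈p))

∈⋃⁻ : ∀ {v : Fin n} ps → v ∈ ⋃ ps → ∃[ p ] (p ∈ˡ ps × v ∈ p)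
∈⋃⁻ []       v∈ = contradiction v∈ ∉⊥
∈⋃⁻ (p ∷ ps) v∈ with x∈p∪q⁻ p (⋃ ps) v∈
... | inj₁ v∈p = p , here refl , v∈p
... | inj₂ v∈⋃ with ∈⋃⁻ ps v∈⋃
...   | q , q∈ , v∈q = q , there q∈ , v∈q

minimiser : (f : Subset n → ℕ) {P : Subset n → Set} → Decidable P → ∃ P →
            ∃[ X ] (P X × (∀ Y → P Y → f X ≤ f Y))
minimiser f {P} P? (X₀ , p₀) = descend X₀ p₀ (<-wellFounded (f X₀))
  where
  descend : ∀ X → P X → Acc _<_ (f X) → ∃[ X ] (P X × (∀ Y → P Y → f X ≤ f Y))
  descend X p (acc rec) with anySubset? (λ Y → P? Y ×-dec (f Y <? f X))
  ... | yes (Y , q , fY<fX) = descend Y q (rec fY<fX)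
  ... | no none = X , p , λ Y q → ℕ.≮⇒≥ λ fY<fX → none (Y , q , fY<fX)

-- Counting

indicator : {A : Set} → Dec A → ℕ
indicator a? = if does a? then 1 else 0

indicator≤1 : {A : Set} (a? : Dec A) → indicator a? ≤ 1
indicator≤1 (yes _) = ≤-refl
indicator≤1 (no _)  = z≤n

indicator-mono : {A B : Set} (a? : Dec A) (b? : Dec B) → (A → B) → indicator a? ≤ indicator b?
indicator-mono (no _)  b?      f = z≤n
indicator-mono (yes a) (yes b) f = ≤-refl
indicator-mono (yes a) (no ¬b) f = contradiction (f a) ¬b

module _ {A : Set} where

  total : (A → ℕ) → List A → ℕ
  total f xs = sum (map f xs)

  total-mono : {f g : A → ℕ} → (∀ x → f x ≤ g x) → ∀ xs → total f xs ≤ total g xs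
  total-mono f≤g []       = z≤n
  total-mono f≤g (x ∷ xs) = +-mono-≤ (f≤g x) (total-mono f≤g xs)

  total-+ : (f g : A → ℕ) → ∀ xs → total (λ x → f x + g x) xs ≡ total f xs + total g xs
  total-+ f g []       = refl
  total-+ f g (x ∷ xs) rewrite total-+ f g xs = interchange (f x) (g x) (total f xs) (total g xs)
    where
    interchange : ∀ a b c d → (a + b) + (c + d) ≡ (a + c) + (b + d)
    interchange = solve-∀

  length-filter : {P : A → Set} (P? : Decidable P) → ∀ xs →
                  length (filter P? xs) ≡ total (indicator ∘ P?) xs
  length-filter P? []       = refl
  length-filter P? (x ∷ xs) with does (P? x)
  ... | true  = cong suc (length-filter P? xs)
  ... | false = length-filter P? xs

  length-filter-mono : {P Q : A → Set} (P? : Decidable P) (Q? : Decidable Q) →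
                       (∀ x → P x → Q x) → ∀ xs → length (filter P? xs) ≤ length (filter Q? xs)
  length-filter-mono P? Q? P⇒Q xs =
    subst₂ _≤_ (sym (length-filter P? xs)) (sym (length-filter Q? xs))
      (total-mono (λ x → indicator-mono (P? x) (Q? x) (P⇒Q x)) xs)

-- For one hyperedge, `P` and `Q` will say that it is cut by the first and by the second
-- k-partition, `M` and `D` that it contains the two kinds of pairs counted by `Φ`.
indicator-+-mono : {P Q M D : Set} (p? : Dec P) (q? : Dec Q) (m? : Dec M) (d? : Dec D) →
  (P → M) → (Q → M) → (P → Q → D) →
  indicator p? + indicator q? ≤ indicator m? + indicator d?
indicator-+-mono (no _)  (no _)  m?       d?      pm qm pqd = z≤n
indicator-+-mono (yes p) q?      (no ¬m)  d?      pm qm pqd = contradiction (pm p) ¬m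
indicator-+-mono (no _)  (yes q) (no ¬m)  d?      pm qm pqd = contradiction (qm q) ¬m
indicator-+-mono (yes p) (no _)  (yes _)  d?      pm qm pqd = s≤s z≤n
indicator-+-mono (no _)  (yes q) (yes _)  d?      pm qm pqd = s≤s z≤n
indicator-+-mono (yes p) (yes q) (yes _)  (yes _) pm qm pqd = ≤-refl
indicator-+-mono (yes p) (yes q) (yes _)  (no ¬d) pm qm pqd = contradiction (pqd p q) ¬d

-- The propositional core of the exchange for one hyperedge: `M` and `D` are the conditions counted
-- by `Φ`, primed once a set `A` is added; `C` says that the hyperedge crosses `A`, and `X` that it
-- crosses `W ∩ A`.
module _ {M D C : Set} (m? : Dec M) (d? : Dec D) (c? : Dec C) where

  at-least-one : M ⊎ C → 1 ≤ indicator m? + indicator d? + indicator c?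
  at-least-one (inj₁ m) rewrite dec-true m? m = s≤s z≤n
  at-least-one (inj₂ c) rewrite dec-true c? c = m≤n+m 1 (indicator m? + indicator d?)

  at-least-two : (D → M) → D ⊎ M × C → 2 ≤ indicator m? + indicator d? + indicator c?
  at-least-two d⇒m (inj₁ d) rewrite dec-true m? (d⇒m d) | dec-true d? d = s≤s (s≤s z≤n)
  at-least-two d⇒m (inj₂ (m , c)) rewrite dec-true m? m | dec-true c? c =
    s≤s (m≤n+m 1 (indicator d?))

  all-three : M → D → C → 3 ≤ indicator m? + indicator d? + indicator c?
  all-three m d c rewrite dec-true m? m | dec-true d? d | dec-true c? c = ≤-refl

  -- The implications yield as many conditions on the right as hold on the left; `D`, which entails
  -- `M`, is worth two.
  indicator-exchange : {M′ D′ X : Set} (m′? : Dec M′) (d′? : Dec D′) (x? : Dec X) →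
    (D′ → M′) → (D → M) → (M′ → M ⊎ C) → (X → M ⊎ C) →
    (D′ → D ⊎ M × C) → (M′ → X → D ⊎ M × C) → (D′ → X → D × C) →
    indicator m′? + indicator d′? + indicator x? ≤ indicator m? + indicator d? + indicator c?
  indicator-exchange (no _)   (no _)   (no _)  _ _ _ _ _ _ _ = z≤n
  indicator-exchange (no _)   (no _)   (yes x) _ _ _ x⇒ _ _ _ = at-least-one (x⇒ x)
  indicator-exchange (no ¬m′) (yes d′) _       d′⇒m′ _ _ _ _ _ _ = contradiction (d′⇒m′ d′) ¬m′
  indicator-exchange (yes m′) (no _)   (no _)  _ _ m′⇒ _ _ _ _ = at-least-one (m′⇒ m′)
  indicator-exchange (yes m′) (no _)   (yes x) _ d⇒m _ _ _ m′x⇒ _ = at-least-two d⇒m (m′x⇒ m′ x)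
  indicator-exchange (yes _)  (yes d′) (no _)  _ d⇒m _ _ d′⇒ _ _ = at-least-two d⇒m (d′⇒ d′)
  indicator-exchange (yes _)  (yes d′) (yes x) _ d⇒m _ _ _ _ d′x⇒ =
    let d , c = d′x⇒ d′ x in all-three (d⇒m d) d c

-- Hyperedges

module _ {X e : Subset n} where

  crosses⁺ : ∀ {u v} → u ∈ e → v ∈ e → u ∈ X → v ∉ X → Crosses X e
  crosses⁺ u∈e v∈e u∈X v∉X = (_ , x∈p∩q⁺ (u∈e , u∈X)) , (_ , x∈p∩q⁺ (v∈e , x∉p⇒x∈∁p v∉X))

  crosses⁻ : Crosses X e → ∃[ u ] ∃[ v ] (u ∈ e × v ∈ e × u ∈ X × v ∉ X)
  crosses⁻ ((u , u∈) , (v , v∈)) with x∈p∩q⁻ e X u∈ | x∈p∩q⁻ e (∁ X) v∈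
  ... | u∈e , u∈X | v∈e , v∈∁X = u , v , u∈e , v∈e , u∈X , x∈∁p⇒x∉p v∈∁X

d-∁-≤ : (G : Hypergraph n) (X : Subset n) → d G (∁ X) ≤ d G X
d-∁-≤ G X = length-filter-mono (crosses? (∁ X)) (crosses? X) swap (edges G)
  where
  swap : ∀ e → Crosses (∁ X) e → Crosses X e
  swap e c with crosses⁻ c
  ... | u , v , u∈e , v∈e , u∈∁X , v∉∁X = crosses⁺ v∈e u∈e (x∉∁p⇒x∈p v∉∁X) (x∈∁p⇒x∉p u∈∁X)

module _ {L : Set} (R : L → L → Set) (f : Fin n → L) (e : Subset n) where

  -- One form for both terms of `Φ` and for being cut by a colouring, so that all are compared
  -- through pairs of vertices.
  HasPair : Set
  HasPair = ∃[ u ] ∃[ v ] (u ∈ e × v ∈ e × R (f u) (f v))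

  hasPair? : (∀ x y → Dec (R x y)) → Dec HasPair
  hasPair? R? = any? λ u → any? λ v → (u ∈? e) ×-dec (v ∈? e) ×-dec R? (f u) (f v)

-- Labels

-- The number of sets containing a vertex, truncated at two; when it is one, that set is remembered.
data Label (m : ℕ) : Set where
  W Z : Label m
  Y   : Fin m → Label m

Y-injective : {i j : Fin m} → Y i ≡ Y j → i ≡ j
Y-injective refl = refl

_≟ᴸ_ : (x y : Label m) → Dec (x ≡ y)
W   ≟ᴸ W   = yes refl
W   ≟ᴸ Z   = no λ ()
W   ≟ᴸ Y _ = no λ ()
Z   ≟ᴸ W   = no λ ()
Z   ≟ᴸ Z   = yes refl
Z   ≟ᴸ Y _ = no λ ()
Y _ ≟ᴸ W   = no λ ()
Y _ ≟ᴸ Z   = no λ ()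
Y i ≟ᴸ Y j = map′ (cong Y) Y-injective (i ≟ j)

-- One order suffices in `wz`, as `HasPair` ranges over ordered pairs. The `yy` pairs account for
-- hyperedges cut by both k-partitions; the `wz` pairs make the exchange hold.
data Conflict {m : ℕ} (x y : Label m) : Set where
  wz : x ≡ W → y ≡ Z → Conflict x y
  yy : ∀ {i j} → x ≡ Y i → y ≡ Y j → i ≢ j → Conflict x y

conflict? : (x y : Label m) → Dec (Conflict x y)
conflict? W     W     = no λ { (wz _ ()) ; (yy () _ _) }
conflict? W     Z     = yes (wz refl refl)
conflict? W     (Y _) = no λ { (wz _ ()) ; (yy () _ _) }
conflict? Z     _     = no λ { (wz () _) ; (yy () _ _) }
conflict? (Y _) W     = no λ { (wz () _) ; (yy _ () _) }
conflict? (Y _) Z     = no λ { (wz () _) ; (yy _ () _) }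
conflict? (Y i) (Y j) = map′ (yy refl refl) (λ { (yy refl refl i≢j) → i≢j }) (¬? (i ≟ j))

conflict⇒≢ : {x y : Label m} → Conflict x y → x ≢ y
conflict⇒≢ (wz refl refl)     ()
conflict⇒≢ (yy refl refl i≢j) eq = i≢j (Y-injective eq)

-- The new label of a vertex, where A is the statement that it lies in the added set.
relabel : {A : Set} → Fin m → Dec A → Label m → Label m
relabel i (no _)  x     = x
relabel i (yes _) W     = W
relabel i (yes _) Z     = Y i
relabel i (yes _) (Y _) = W

module _ {A : Set} {i : Fin m} where

  relabel-W⁻ : (a? : Dec A) (x : Label m) → relabel i a? x ≡ W → x ≡ W ⊎ A × x ≢ Z
  relabel-W⁻ (no _)  x     eq = inj₁ eq
  relabel-W⁻ (yes _) W     eq = inj₁ refl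
  relabel-W⁻ (yes a) (Y _) eq = inj₂ (a , λ ())

  relabel-Z⁻ : (a? : Dec A) (x : Label m) → relabel i a? x ≡ Z → ¬ A × x ≡ Z
  relabel-Z⁻ (no ¬a) x     eq = ¬a , eq
  relabel-Z⁻ (yes a) W     ()
  relabel-Z⁻ (yes a) Z     ()
  relabel-Z⁻ (yes a) (Y _) ()

  relabel-Y⁻ : ∀ {j} (a? : Dec A) (x : Label m) → relabel i a? x ≡ Y j →
               (¬ A × x ≡ Y j) ⊎ (A × x ≡ Z × i ≡ j)
  relabel-Y⁻ (no ¬a) x eq = inj₁ (¬a , eq)
  relabel-Y⁻ (yes a) Z eq = inj₂ (a , refl , Y-injective eq)

  relabel-yes-≢Z : (a? : Dec A) (x : Label m) → A → x ≢ Z → relabel i a? x ≡ W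
  relabel-yes-≢Z (no ¬a) x     a x≢Z = contradiction a ¬a
  relabel-yes-≢Z (yes _) W     a x≢Z = refl
  relabel-yes-≢Z (yes _) Z     a x≢Z = contradiction refl x≢Z
  relabel-yes-≢Z (yes _) (Y _) a x≢Z = refl

  relabel-W : (a? : Dec A) → relabel i a? W ≡ W
  relabel-W (yes _) = refl
  relabel-W (no _)  = refl

  relabel-no : (a? : Dec A) (x : Label m) → ¬ A → relabel i a? x ≡ x
  relabel-no (no _)  x ¬a = refl
  relabel-no (yes a) x ¬a = contradiction a ¬a

  relabel-yes-Z : (a? : Dec A) → A → relabel i a? Z ≡ Y i
  relabel-yes-Z (yes _) a = refl
  relabel-yes-Z (no ¬a) a = contradiction a ¬a

relabel-cong : {A B : Set} {i : Fin m} (a? : Dec A) (b? : Dec B) {x y : Label m} →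
               (A → B) → (B → A) → x ≡ y → relabel i a? x ≡ relabel i b? y
relabel-cong (no _)  (no _)          f g refl = refl
relabel-cong (no ¬a) (yes b)         f g refl = contradiction (g b) ¬a
relabel-cong (yes a) (no ¬b)         f g refl = contradiction (f a) ¬b
relabel-cong (yes _) (yes _) {W}     f g refl = refl
relabel-cong (yes _) (yes _) {Z}     f g refl = refl
relabel-cong (yes _) (yes _) {Y _}   f g refl = refl

-- The contribution of a single hyperedge; the potential itself is its `total` over the edges.
Φ : (Fin n → Label m) → Subset n → ℕ
Φ ℓ e = indicator (hasPair? _≢_ ℓ e λ x y → ¬? (x ≟ᴸ y)) + indicator (hasPair? Conflict ℓ e conflict?)

-- Change of the potential when a set is added

module Exchange (ℓ : Fin n → Label m) (A : Subset n) (i : Fin m) where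

  ℓ⁺ : Fin n → Label m
  ℓ⁺ v = relabel i (v ∈? A) (ℓ v)

  WA? : Decidable (λ v → ℓ v ≡ W × v ∈ A)
  WA? v = (ℓ v ≟ᴸ W) ×-dec (v ∈? A)

  WA : Subset n
  WA = ⟦ WA? ⟧

  module _ (e : Subset n) where

    M D M⁺ D⁺ C X : Set
    M  = HasPair _≢_ ℓ e
    D  = HasPair Conflict ℓ e
    M⁺ = HasPair _≢_ ℓ⁺ e
    D⁺ = HasPair Conflict ℓ⁺ e
    C  = Crosses A e
    X  = Crosses WA e

    D⇒M : D → M
    D⇒M (u , v , u∈ , v∈ , c) = u , v , u∈ , v∈ , conflict⇒≢ c

    D⁺⇒M⁺ : D⁺ → M⁺
    D⁺⇒M⁺ (u , v , u∈ , v∈ , c) = u , v , u∈ , v∈ , conflict⇒≢ c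

    -- Vertices with equal old labels on the same side of `A` get equal new labels.
    M⁺⇒M⊎C : M⁺ → M ⊎ C
    M⁺⇒M⊎C (u , v , u∈ , v∈ , ne) = case (ℓ u ≟ᴸ ℓ v) , (u ∈? A) , (v ∈? A) of λ where
      (no ≢ℓ , _ , _)                → inj₁ (u , v , u∈ , v∈ , ≢ℓ)
      (yes _ , yes u∈A , no v∉A)     → inj₂ (crosses⁺ u∈ v∈ u∈A v∉A)
      (yes _ , no u∉A , yes v∈A)     → inj₂ (crosses⁺ v∈ u∈ v∈A u∉A)
      (yes ≡ℓ , yes u∈A , yes v∈A)   →
        contradiction (relabel-cong (u ∈? A) (v ∈? A) (λ _ → v∈A) (λ _ → u∈A) ≡ℓ) ne
      (yes ≡ℓ , no u∉A , no v∉A)     →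
        contradiction (relabel-cong (u ∈? A) (v ∈? A) (λ p → contradiction p u∉A) (λ p → contradiction p v∉A) ≡ℓ) ne

    X⇒M⊎C : X → M ⊎ C
    X⇒M⊎C x with crosses⁻ x
    ... | u , v , u∈ , v∈ , u∈WA , v∉WA with ∈⟦⟧⁻ WA? u∈WA | ℓ v ≟ᴸ W
    ...   | ℓu≡W , u∈A | no ℓv≢W  = inj₁ (u , v , u∈ , v∈ , λ eq → ℓv≢W (trans (sym eq) ℓu≡W))
    ...   | ℓu≡W , u∈A | yes ℓv≡W = inj₂ (crosses⁺ u∈ v∈ u∈A λ v∈A → v∉WA (∈⟦⟧⁺ WA? (ℓv≡W , v∈A)))

    -- If both vertices keep their labels, the conflict is an old one. Otherwise exactly one label
    -- changes: that vertex is in `A`, the other is not, and their old labels differ.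
    D⁺⇒D⊎M×C : D⁺ → D ⊎ M × C
    D⁺⇒D⊎M×C (u , v , u∈ , v∈ , wz eq eq′)
      with relabel-W⁻ (u ∈? A) (ℓ u) eq | relabel-Z⁻ (v ∈? A) (ℓ v) eq′
    ... | inj₁ ℓu≡W         | _   , ℓv≡Z = inj₁ (u , v , u∈ , v∈ , wz ℓu≡W ℓv≡Z)
    ... | inj₂ (u∈A , ℓu≢Z) | v∉A , ℓv≡Z =
      inj₂ ((u , v , u∈ , v∈ , λ eq → ℓu≢Z (trans eq ℓv≡Z)) , crosses⁺ u∈ v∈ u∈A v∉A)
    D⁺⇒D⊎M×C (u , v , u∈ , v∈ , yy eq eq′ i≢j)
      with relabel-Y⁻ (u ∈? A) (ℓ u) eq | relabel-Y⁻ (v ∈? A) (ℓ v) eq′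
    ... | inj₁ (_ , ℓu≡Y)       | inj₁ (_ , ℓv≡Y)   = inj₁ (u , v , u∈ , v∈ , yy ℓu≡Y ℓv≡Y i≢j)
    ... | inj₁ (u∉A , ℓu≡Y)     | inj₂ (v∈A , ℓv≡Z , _) =
      inj₂ ((u , v , u∈ , v∈ , λ eq → case trans (sym ℓu≡Y) (trans eq ℓv≡Z) of λ ()) , crosses⁺ v∈ u∈ v∈A u∉A)
    ... | inj₂ (u∈A , ℓu≡Z , _) | inj₁ (v∉A , ℓv≡Y) =
      inj₂ ((u , v , u∈ , v∈ , λ eq → case trans (sym ℓu≡Z) (trans eq ℓv≡Y) of λ ()) , crosses⁺ u∈ v∈ u∈A v∉A)
    ... | inj₂ (_ , _ , refl)   | inj₂ (_ , _ , refl) = contradiction refl i≢j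

    W-vertex : X → ∃[ u ] (u ∈ e × ℓ u ≡ W × u ∈ A)
    W-vertex x with crosses⁻ x
    ... | u , _ , u∈ , _ , u∈WA , _ = u , u∈ , ∈⟦⟧⁻ WA? u∈WA

    -- Let `u` be a vertex of `e` in `W ∩ A`. If `x` or `y` has label `Z`, it conflicts with `u`.
    -- Otherwise, were both in `A` or both in `W`, both would now be labelled `W`; so one is outside
    -- `A` and one outside `W`, and each is paired with `u`.
    M⁺∧X⇒D⊎M×C : M⁺ → X → D ⊎ M × C
    M⁺∧X⇒D⊎M×C (x , y , x∈ , y∈ , ne) cross with W-vertex cross
    ... | u , u∈ , ℓu≡W , u∈A with ℓ x ≟ᴸ Z | ℓ y ≟ᴸ Z
    ...   | yes ℓx≡Z | _        = inj₁ (u , x , u∈ , x∈ , wz ℓu≡W ℓx≡Z)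
    ...   | no _     | yes ℓy≡Z = inj₁ (u , y , u∈ , y∈ , wz ℓu≡W ℓy≡Z)
    ...   | no ℓx≢Z  | no ℓy≢Z  = inj₂ (non-W , outside-A)
      where
      fromW : ∀ {v} → v ∈ e → ℓ v ≢ W → M
      fromW v∈ ℓv≢W = u , _ , u∈ , v∈ , λ eq → ℓv≢W (trans (sym eq) ℓu≡W)

      stays : ∀ {v} → ℓ v ≡ W → ℓ⁺ v ≡ W
      stays {v} eq = trans (cong (relabel i (v ∈? A)) eq) (relabel-W (v ∈? A))

      non-W : M
      non-W with ℓ x ≟ᴸ W | ℓ y ≟ᴸ W
      ... | no ℓx≢W  | _        = fromW x∈ ℓx≢W
      ... | yes _    | no ℓy≢W  = fromW y∈ ℓy≢W
      ... | yes ℓx≡W | yes ℓy≡W = contradiction (trans (stays ℓx≡W) (sym (stays ℓy≡W))) ne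

      outside-A : C
      outside-A = case (x ∈? A) , (y ∈? A) of λ where
        (no x∉A , _)          → crosses⁺ u∈ x∈ u∈A x∉A
        (yes _ , no y∉A)      → crosses⁺ u∈ y∈ u∈A y∉A
        (yes x∈A , yes y∈A)   → contradiction
          (trans (relabel-yes-≢Z (x ∈? A) _ x∈A ℓx≢Z) (sym (relabel-yes-≢Z (y ∈? A) _ y∈A ℓy≢Z))) ne

    -- Some vertex of a new conflict lies outside `A`, so `e` crosses `A` there and at `u`. A vertex
    -- whose old label is `Z` conflicts with `u`; if there is none, the pair was already a `yy`
    -- conflict.
    D⁺∧X⇒D×C : D⁺ → X → D × C
    D⁺∧X⇒D×C (x , y , x∈ , y∈ , c) cross with W-vertex cross
    ... | u , u∈ , ℓu≡W , u∈A = go c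
      where
      clash : ∀ {v} → v ∈ e → ℓ v ≡ Z → D
      clash v∈ ℓv≡Z = u , _ , u∈ , v∈ , wz ℓu≡W ℓv≡Z

      leave : ∀ {v} → v ∈ e → v ∉ A → C
      leave v∈ v∉A = crosses⁺ u∈ v∈ u∈A v∉A

      go : Conflict (ℓ⁺ x) (ℓ⁺ y) → D × C
      go (wz _ eq′) with relabel-Z⁻ (y ∈? A) (ℓ y) eq′
      ... | y∉A , ℓy≡Z = clash y∈ ℓy≡Z , leave y∈ y∉A
      go (yy eq eq′ i≢j) with relabel-Y⁻ (x ∈? A) (ℓ x) eq | relabel-Y⁻ (y ∈? A) (ℓ y) eq′
      ... | inj₁ (x∉A , ℓx≡Y)   | inj₁ (_ , ℓy≡Y)     = (x , y , x∈ , y∈ , yy ℓx≡Y ℓy≡Y i≢j) , leave x∈ x∉A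
      ... | inj₁ (x∉A , _)      | inj₂ (_ , ℓy≡Z , _) = clash y∈ ℓy≡Z , leave x∈ x∉A
      ... | inj₂ (_ , ℓx≡Z , _) | inj₁ (y∉A , _)      = clash x∈ ℓx≡Z , leave y∈ y∉A
      ... | inj₂ (_ , _ , refl) | inj₂ (_ , _ , refl) = contradiction refl i≢j

    Φ-exchange : Φ ℓ⁺ e + indicator (crosses? WA e) ≤ Φ ℓ e + indicator (crosses? A e)
    Φ-exchange = indicator-exchange
      (hasPair? _≢_ ℓ e λ x y → ¬? (x ≟ᴸ y)) (hasPair? Conflict ℓ e conflict?) (crosses? A e)
      (hasPair? _≢_ ℓ⁺ e λ x y → ¬? (x ≟ᴸ y)) (hasPair? Conflict ℓ⁺ e conflict?) (crosses? WA e)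
      D⁺⇒M⁺ D⇒M M⁺⇒M⊎C X⇒M⊎C D⁺⇒D⊎M×C M⁺∧X⇒D⊎M×C D⁺∧X⇒D×C

  totalΦ-exchange : (G : Hypergraph n) → total (Φ ℓ⁺) (edges G) + d G WA ≤ total (Φ ℓ) (edges G) + d G A
  totalΦ-exchange G = subst₂ _≤_ (split ℓ⁺ WA) (split ℓ A) (total-mono Φ-exchange (edges G))
    where
    split : ∀ ℓ′ B → total (λ e → Φ ℓ′ e + indicator (crosses? B e)) (edges G) ≡ total (Φ ℓ′) (edges G) + d G B
    split ℓ′ B = trans (total-+ (Φ ℓ′) (indicator ∘ crosses? B) (edges G))
      (cong (total (Φ ℓ′) (edges G) +_) (sym (length-filter (crosses? B) (edges G))))

-- Labels from a list of sets, and the bound on the potential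

module _ (A : Fin m → Subset n) where

  labels : List (Fin m) → Fin n → Label m
  labels []       v = Z
  labels (i ∷ is) v = relabel i (v ∈? A i) (labels is v)

  labels-Z : ∀ {v is} → All (λ i → v ∉ A i) is → labels is v ≡ Z
  labels-Z []           = refl
  labels-Z (v∉A ∷ rest) = trans (relabel-no (_ ∈? A _) _ v∉A) (labels-Z rest)

  labels-Y : ∀ {v i is} → Unique is → i ∈ˡ is → v ∈ A i → (∀ {j} → i ≢ j → v ∉ A j) → labels is v ≡ Y i
  labels-Y {v} {i} (i≢ ∷ _) (here refl) v∈A v∉A =
    trans (cong (relabel i (v ∈? A i)) (labels-Z (All.map v∉A i≢))) (relabel-yes-Z (v ∈? A i) v∈A)
  labels-Y {v} {i} {j ∷ _} (j≢ ∷ uniq) (there i∈) v∈A v∉A =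
    trans (relabel-no (v ∈? A j) _ (v∉A (All.lookup j≢ i∈ ∘ sym))) (labels-Y uniq i∈ v∈A v∉A)

  -- Once `A j` is added the label is not `Z`, as that would mean `v ∉ A j`; adding `A i` then makes
  -- it `W`.
  labels-W : ∀ {v} is → (∀ i → v ∈ A i) → 2 ≤ length is → labels is v ≡ W
  labels-W {v} (i ∷ j ∷ _) v∈A _ =
    relabel-yes-≢Z (v ∈? A i) _ (v∈A i) λ eq → proj₁ (relabel-Z⁻ (v ∈? A j) _ eq) (v∈A j)
  labels-W (_ ∷ []) _ (s≤s ())

module _ (G : Hypergraph n) (T : Subset n) (A : Fin m → Subset n) (c : ℕ)
         (T⊆A : ∀ i → T ⊆ A i) (dA≤c : ∀ i → d G (A i) ≤ c)
         (dA-min : ∀ i X → T ⊆ X → X ⊆ A i → d G (A i) ≤ d G X) where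

  totalΦ : List (Fin m) → ℕ
  totalΦ is = total (Φ (labels A is)) (edges G)

  totalΦ-[] : totalΦ [] ≤ 0
  totalΦ-[] = ≤-trans (total-mono Φ-[] (edges G)) (zeros (edges G))
    where
    Φ-[] : ∀ e → Φ (labels A []) e ≤ 0
    Φ-[] e
      rewrite dec-false (hasPair? _≢_ (labels A []) e λ x y → ¬? (x ≟ᴸ y)) (λ (_ , _ , _ , _ , ne) → ne refl)
            | dec-false (hasPair? Conflict (labels A []) e conflict?) (λ (_ , _ , _ , _ , c) → conflict⇒≢ c refl) = z≤n

    zeros : ∀ es → total (λ _ → 0) es ≤ 0
    zeros []       = z≤n
    zeros (_ ∷ es) = zeros es

  totalΦ-∷ : ∀ i is → totalΦ (i ∷ is) ≤ totalΦ is + c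
  totalΦ-∷ i is = ≤-trans (m≤m+n _ _)
    (≤-trans (Exchange.totalΦ-exchange (labels A is) (A i) i G) (+-monoʳ-≤ (totalΦ is) (dA≤c i)))

  -- With two sets already present, `T` lies in `W`, so `WA` lies between `T` and `A i`. Then
  -- `dA-min` lets `d G WA` absorb `d G (A i)`.
  totalΦ-∷∷∷ : ∀ i j₁ j₂ js → totalΦ (i ∷ j₁ ∷ j₂ ∷ js) ≤ totalΦ (j₁ ∷ j₂ ∷ js)
  totalΦ-∷∷∷ i j₁ j₂ js = +-cancelʳ-≤ (d G WA) _ _
    (≤-trans (totalΦ-exchange G) (+-monoʳ-≤ (totalΦ (j₁ ∷ j₂ ∷ js)) (dA-min i WA T⊆WA (proj₂ ∘ ∈⟦⟧⁻ WA?))))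
    where
    open Exchange (labels A (j₁ ∷ j₂ ∷ js)) (A i) i

    T⊆WA : T ⊆ WA
    T⊆WA v∈T = ∈⟦⟧⁺ WA? (labels-W A (j₁ ∷ j₂ ∷ js) (λ j → T⊆A j v∈T) (s≤s (s≤s z≤n)) , T⊆A i v∈T)

  -- The first two sets add at most `c` each, every later one nothing.
  totalΦ-bound : ∀ is → totalΦ is ≤ c + c
  totalΦ-bound []                = ≤-trans totalΦ-[] z≤n
  totalΦ-bound (i ∷ [])          = ≤-trans (totalΦ-∷ i []) (+-monoˡ-≤ c (≤-trans totalΦ-[] z≤n))
  totalΦ-bound (i ∷ j ∷ [])      = ≤-trans (totalΦ-∷ i (j ∷ []))
    (+-monoˡ-≤ c (≤-trans (totalΦ-∷ j []) (+-monoˡ-≤ c totalΦ-[])))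
  totalΦ-bound (i ∷ j₁ ∷ j₂ ∷ js) = ≤-trans (totalΦ-∷∷∷ i j₁ j₂ js) (totalΦ-bound (j₁ ∷ j₂ ∷ js))

-- Partitions from colourings

module _ (colour : Fin n → Fin k) where

  fibre : Fin k → Subset n
  fibre i = ⟦ (λ v → colour v ≟ i) ⟧

  ∈-fibre : ∀ v → v ∈ fibre (colour v)
  ∈-fibre v = ∈⟦⟧⁺ (λ v → colour v ≟ _) refl

  ∈-fibre⁻ : ∀ {i v} → v ∈ fibre i → colour v ≡ i
  ∈-fibre⁻ = ∈⟦⟧⁻ (λ v → colour v ≟ _)

  fibre-isPartition : (∀ i → ∃[ v ] colour v ≡ i) → IsPartition fibre
  fibre-isPartition onto = record
    { nonempty = λ i → let v , eq = onto i in v , subst (λ j → v ∈ fibre j) eq (∈-fibre v)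
    ; disjoint = λ {i} {j} i≢j (v , v∈) →
        let v∈i , v∈j = x∈p∩q⁻ (fibre i) (fibre j) v∈ in
        i≢j (trans (sym (∈-fibre⁻ v∈i)) (∈-fibre⁻ v∈j))
    ; covering = λ v → colour v , ∈-fibre v
    }

  fibre-meetsTwoParts⁻ : ∀ e → MeetsTwoParts fibre e → HasPair _≢_ colour e
  fibre-meetsTwoParts⁻ e (i , j , i≢j , (u , u∈) , (v , v∈)) =
    let u∈e , u∈i = x∈p∩q⁻ e (fibre i) u∈
        v∈e , v∈j = x∈p∩q⁻ e (fibre j) v∈
    in u , v , u∈e , v∈e , λ eq → i≢j (trans (sym (∈-fibre⁻ u∈i)) (trans eq (∈-fibre⁻ v∈j)))

-- The last colour collects `W`, `Z` and the unchosen `Y` classes. Being last, it stays out of the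
-- first half of the parts.
colourBy : (Fin m → Maybe (Fin K)) → Label m → Fin (suc K)
colourBy {K = K} part (Y i) = maybe′ inject₁ (fromℕ K) (part i)
colourBy {K = K} part _     = fromℕ K

colourBy-≢last : (part : Fin m → Maybe (Fin K)) (x : Label m) → colourBy part x ≢ fromℕ K →
                 ∃[ i ] ∃[ b ] (x ≡ Y i × part i ≡ just b)
colourBy-≢last part W     ne = contradiction refl ne
colourBy-≢last part Z     ne = contradiction refl ne
colourBy-≢last part (Y i) ne with part i in eq
... | just b  = i , b , refl , eq
... | nothing = contradiction refl ne

module _ (part part′ : Fin m → Maybe (Fin K))
         (separate : ∀ {i b b′} → part i ≡ just b → part′ i ≡ just b′ → ⊥)
         (ℓ : Fin n → Label m) (e : Subset n) where

  private
    ≢last-vertex : (part : Fin m → Maybe (Fin K)) → HasPair _≢_ (colourBy part ∘ ℓ) e →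
                   ∃[ u ] (u ∈ e × colourBy part (ℓ u) ≢ fromℕ K)
    ≢last-vertex part (u , v , u∈ , v∈ , ne) with colourBy part (ℓ u) ≟ fromℕ K
    ... | no ≢last  = u , u∈ , ≢last
    ... | yes ≡last = v , v∈ , λ eq → ne (trans ≡last (sym eq))

  -- Under each colouring some vertex of `e` avoids the last colour, hence lies in a chosen `Y`
  -- class; no class is chosen by both.
  bichromatic-twice⇒conflict : HasPair _≢_ (colourBy part ∘ ℓ) e → HasPair _≢_ (colourBy part′ ∘ ℓ) e →
                               HasPair Conflict ℓ e
  bichromatic-twice⇒conflict p p′ with ≢last-vertex part p | ≢last-vertex part′ p′
  ... | u , u∈ , u≢ | v , v∈ , v≢ with colourBy-≢last part (ℓ u) u≢ | colourBy-≢last part′ (ℓ v) v≢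
  ...   | i , b , ℓu≡Y , eq | j , b′ , ℓv≡Y , eq′ =
    u , v , u∈ , v∈ , yy ℓu≡Y ℓv≡Y λ { refl → separate eq eq′ }

  -- Each colouring merges label classes, so a cut hyperedge has two labels; one cut twice also has
  -- a conflict and counts two in `Φ`.
  cost-sum≤Φ :
    indicator (meetsTwoParts? (fibre (colourBy part ∘ ℓ)) e) +
    indicator (meetsTwoParts? (fibre (colourBy part′ ∘ ℓ)) e) ≤ Φ ℓ e
  cost-sum≤Φ = indicator-+-mono (meetsTwoParts? _ e) (meetsTwoParts? _ e)
    (hasPair? _≢_ ℓ e λ x y → ¬? (x ≟ᴸ y)) (hasPair? Conflict ℓ e conflict?)
    (refine part ∘ fibre-meetsTwoParts⁻ (colourBy part ∘ ℓ) e)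
    (refine part′ ∘ fibre-meetsTwoParts⁻ (colourBy part′ ∘ ℓ) e)
    λ p p′ → bichromatic-twice⇒conflict
      (fibre-meetsTwoParts⁻ (colourBy part ∘ ℓ) e p) (fibre-meetsTwoParts⁻ (colourBy part′ ∘ ℓ) e p′)
    where
    refine : (part : Fin m → Maybe (Fin K)) → HasPair _≢_ (colourBy part ∘ ℓ) e → HasPair _≢_ ℓ e
    refine part (u , v , u∈ , v∈ , ne) = u , v , u∈ , v∈ , ne ∘ cong (colourBy part)

firstPart lastPart : ∀ K → Fin (K + K) → Maybe (Fin K)
firstPart K = [ just , (λ _ → nothing) ]′ ∘ splitAt K
lastPart  K = [ (λ _ → nothing) , just ]′ ∘ splitAt K

firstPart-lastPart : ∀ K i {b b′} → firstPart K i ≡ just b → lastPart K i ≡ just b′ → ⊥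
firstPart-lastPart K i eq eq′ with splitAt K i
firstPart-lastPart K i eq () | inj₁ _
firstPart-lastPart K i () eq′ | inj₂ _

+-≤-halves : ∀ {a b c} → a + b ≤ c + c → a ≤ c ⊎ b ≤ c
+-≤-halves {a} {b} {c} le with a ≤? c | b ≤? c
... | yes a≤c | _       = inj₁ a≤c
... | no _    | yes b≤c = inj₂ b≤c
... | no a≰c  | no b≰c  = contradiction le (<⇒≱ (+-mono-< (≰⇒> a≰c) (≰⇒> b≰c)))

-- Here `K` is `k - 1`. The last part contains `u₀` and all of `∁ U`, so the other parts lie in `U`
-- and miss `u₀`.
CheapPartition : Hypergraph n → Subset n → Fin n → ℕ → Set
CheapPartition {n} G U u₀ K = ∃ λ (P : Fin (suc K) → Subset n) →
  IsPartition P × cost G P ≤ d G U × (∀ i → i ≢ fromℕ K → P i ⊆ U) × u₀ ∈ P (fromℕ K)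

module _ (G : Hypergraph n) (U : Subset n) (u₀ : Fin n) (1≤K : 1 ≤ K)
         (A : Fin (K + K) → Subset n) (s : Fin (K + K) → Fin n)
         (∁U⊆A : ∀ i → ∁ U ⊆ A i) (u₀∉A : ∀ i → u₀ ∉ A i)
         (s∈A : ∀ i → s i ∈ A i) (s∉A : ∀ {i j} → i ≢ j → s i ∉ A j)
         (dA≤dU : ∀ i → d G (A i) ≤ d G U)
         (dA-min : ∀ i X → ∁ U ⊆ X → X ⊆ A i → d G (A i) ≤ d G X) where

  private
    indices : List (Fin (K + K))
    indices = allFin (K + K)

    ℓ : Fin n → Label (K + K)
    ℓ = labels A indices

    ℓ-s : ∀ i → ℓ (s i) ≡ Y i
    ℓ-s i = labels-Y A (allFin⁺ (K + K)) (∈-allFin i) (s∈A i) s∉A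

    ℓ-u₀ : ℓ u₀ ≡ Z
    ℓ-u₀ = labels-Z A (All.universal u₀∉A indices)

    ℓ-∁U : ∀ {v} → v ∈ ∁ U → ℓ v ≡ W
    ℓ-∁U v∈ = labels-W A indices (λ i → ∁U⊆A i v∈) (subst (2 ≤_) (sym (length-tabulate {n = K + K} (λ i → i))) (+-mono-≤ 1≤K 1≤K))

    cheap : (part : Fin (K + K) → Maybe (Fin K)) → (∀ b → ∃[ i ] part i ≡ just b) →
            cost G (fibre (colourBy part ∘ ℓ)) ≤ d G U → CheapPartition G U u₀ K
    cheap part onto le = fibre c , fibre-isPartition c c-onto , le , inner ,
      subst (λ i → u₀ ∈ fibre c i) (cong (colourBy part) ℓ-u₀) (∈-fibre c u₀)
      where
      c : Fin n → Fin (suc K)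
      c = colourBy part ∘ ℓ

      c-onto : ∀ i → ∃[ v ] c v ≡ i
      -- Non-emptiness: `u₀` witnesses the last colour, and the private vertex `s j` the colour of
      -- class `j`.
      c-onto i with view i
      ... | ‵fromℕ     = u₀ , cong (colourBy part) ℓ-u₀
      ... | ‵inject₁ b = let j , eq = onto b in
        s j , trans (cong (colourBy part) (ℓ-s j)) (cong (maybe′ inject₁ (fromℕ K)) eq)

      inner : ∀ i → i ≢ fromℕ K → fibre c i ⊆ U
      inner i i≢ {v} v∈ = x∉∁p⇒x∈p λ v∈∁U →
        i≢ (trans (sym (∈-fibre⁻ c v∈)) (cong (colourBy part) (ℓ-∁U v∈∁U)))

  cheapPartition : CheapPartition G U u₀ K
  cheapPartition with +-≤-halves {cost G P₁} {cost G P₂} {d G U} bound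
    where
    P₁ P₂ : Fin (suc K) → Subset n
    P₁ = fibre (colourBy (firstPart K) ∘ ℓ)
    P₂ = fibre (colourBy (lastPart K) ∘ ℓ)

    bound : cost G P₁ + cost G P₂ ≤ d G U + d G U
    bound rewrite length-filter (meetsTwoParts? P₁) (edges G) | length-filter (meetsTwoParts? P₂) (edges G) =
      ≤-trans (≤-reflexive (sym (total-+ _ _ (edges G))))
        (≤-trans (total-mono (cost-sum≤Φ (firstPart K) (lastPart K) (λ {i} → firstPart-lastPart K i) ℓ) (edges G))
          (totalΦ-bound G (∁ U) A (d G U) ∁U⊆A dA≤dU dA-min indices))
  ... | inj₁ le = cheap (firstPart K) (λ b → b ↑ˡ K , cong [ just , _ ]′ (splitAt-↑ˡ K b K)) le
  ... | inj₂ le = cheap (lastPart K) (λ b → K ↑ʳ b , cong [ _ , just ]′ (splitAt-↑ʳ K K b)) le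

-- Balanced splits

module _ {k : ℕ} (P : Fin k → Subset n) where

  ∈-firstHalf⁺ : ∀ {v} i → toℕ i < ⌊ k /2⌋ → v ∈ P i → v ∈ firstHalf P
  ∈-firstHalf⁺ i i<h v∈ = ∈⋃⁺ (∈-map∘filter⁺ P (λ i → toℕ i <? ⌊ k /2⌋) (i , ∈-allFin i , refl , i<h)) v∈

  ∈-firstHalf⁻ : ∀ {v} → v ∈ firstHalf P → ∃[ i ] (toℕ i < ⌊ k /2⌋ × v ∈ P i)
  ∈-firstHalf⁻ v∈ with ∈⋃⁻ (map P (filter (λ i → toℕ i <? ⌊ k /2⌋) (allFin k))) v∈
  ... | _ , p∈ , v∈p with ∈-map∘filter⁻ P (λ i → toℕ i <? ⌊ k /2⌋) {xs = allFin k} p∈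
  ...   | i , _ , refl , i<h = i , i<h , v∈p

  -- Applied to the minimum partition behind `U`, this makes every partition of cost at most `d G U`
  -- a minimum one.
  d-firstHalf≤cost : (G : Hypergraph n) → IsPartition P → d G (firstHalf P) ≤ cost G P
  d-firstHalf≤cost G isP = length-filter-mono (crosses? (firstHalf P)) (meetsTwoParts? P) separated (edges G)
    where
    separated : ∀ e → Crosses (firstHalf P) e → MeetsTwoParts P e
    separated e c with crosses⁻ c
    ... | u , v , u∈ , v∈ , u∈h , v∉h with ∈-firstHalf⁻ u∈h | IsPartition.covering isP v
    ...   | i , i<h , u∈Pᵢ | j , v∈Pⱼ =
      i , j , (λ { refl → v∉h (∈-firstHalf⁺ i i<h v∈Pⱼ) }) ,
      (u , x∈p∩q⁺ (u∈ , u∈Pᵢ)) , (v , x∈p∩q⁺ (v∈ , v∈Pⱼ))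

minimalSplit⇒¬cheap : (G : Hypergraph n) (U : Subset n) (u₀ : Fin n) → 1 ≤ K →
  IsMinimalBalancedSplit G (suc K) U → u₀ ∈ U → ¬ CheapPartition G U u₀ K
minimalSplit⇒¬cheap {n} {K} G U u₀ (s≤s _) ((_ , P , (isP , P-min) , refl) , minimal) u₀∈U
                    (Q , isQ , cheap , inner , u₀∈last) =
  minimal (firstHalf Q , (is2 , Q , (isQ , Q-min) , refl) , Q⊆U , u₀ , u₀∈U , u₀∉Q)
  where
  Q-min : ∀ R → IsPartition R → cost G Q ≤ cost G R
  Q-min R isR = ≤-trans cheap (≤-trans (d-firstHalf≤cost P G isP) (P-min R isR))

  <half⇒≢last : ∀ {i : Fin (suc K)} → toℕ i < ⌊ suc K /2⌋ → i ≢ fromℕ K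
  <half⇒≢last i<h refl =
    -- Half of `K + 1`, rounded down, is at most `K`, so the index `K` is not in the first half.
    <⇒≱ (subst (_< ⌊ suc K /2⌋) (toℕ-fromℕ K) i<h) (s≤s⁻¹ (⌊n/2⌋<n K))

  Q⊆U : firstHalf Q ⊆ U
  Q⊆U v∈ with ∈-firstHalf⁻ Q v∈
  ... | i , i<h , v∈Qᵢ = inner i (<half⇒≢last i<h) v∈Qᵢ

  u₀∉Q : u₀ ∉ firstHalf Q
  u₀∉Q u₀∈ with ∈-firstHalf⁻ Q u₀∈
  ... | i , i<h , u₀∈Qᵢ = IsPartition.disjoint isQ (<half⇒≢last i<h) (u₀ , x∈p∩q⁺ (u₀∈Qᵢ , u₀∈last))

  is2 : Is2Partition (firstHalf Q)
  -- Matching on `1 ≤ K` has made `K` a successor, so part `zero` is in the first half.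
  is2 = (let v , v∈ = IsPartition.nonempty isQ zero in v , ∈-firstHalf⁺ Q zero (s≤s z≤n) v∈) ,
        (u₀ , x∉p⇒x∈∁p u₀∉Q)

-- Terminal sets

module _ (G : Hypergraph n) (U : Subset n) (u₀ : Fin n) where

  Rival : Subset n → Subset n → Set
  Rival S B = S ⊆ B × u₀ ∈ B × B ⊆ U × ¬ (U ⊆ B)

  rival? : ∀ S → Decidable (Rival S)
  rival? S B = (S ⊆? B) ×-dec (u₀ ∈? B) ×-dec (B ⊆? U) ×-dec ¬? (U ⊆? B)

  -- Ties count, so that an unbeaten `S` certifies uniqueness and not only minimality.
  Beaten : Subset n → Set
  Beaten S = ∃[ B ] (Rival S B × d G B ≤ d G U)

  beaten? : Decidable Beaten
  beaten? S = anySubset? λ B → rival? S B ×-dec (d G B ≤? d G U)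

  module _ (S : Subset n) (unbeaten : ¬ Beaten S) (critical : ∀ {u} → u ∈ S → Beaten (S - u)) where

    private
      -- A rival of least `d` is taken instead of the one from `critical`: its complement, the set
      -- `A u`, must satisfy the minimality used in the exchange.
      best : ∀ {u} → u ∈ S → ∃[ B ] (Rival (S - u) B × (∀ B′ → Rival (S - u) B′ → d G B ≤ d G B′))
      best {u} u∈S = minimiser (d G) (rival? (S - u)) (let B , r , _ = critical u∈S in B , r)

      cut : ∀ {u} → u ∈ S → Subset n
      cut = proj₁ ∘ best

      d-cut≤ : ∀ {u} (u∈S : u ∈ S) → d G (cut u∈S) ≤ d G U
      d-cut≤ u∈S = let B , r , dB≤dU = critical u∈S in ≤-trans (proj₂ (proj₂ (best u∈S)) B r) dB≤dU

      ∈cut : ∀ {u v} (u∈S : u ∈ S) → v ∈ S → v ≢ u → v ∈ cut u∈S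
      ∈cut u∈S v∈S v≢u = proj₁ (proj₁ (proj₂ (best u∈S))) (x∈p∧x≢y⇒x∈p-y v∈S v≢u)

      -- Otherwise the cut would contain all of `S` and beat it.
      ∉cut : ∀ {u} (u∈S : u ∈ S) → u ∉ cut u∈S
      ∉cut {u} u∈S u∈cut = let _ , r = proj₁ (proj₂ (best u∈S)) in
        unbeaten (cut u∈S , (S⊆cut , r) , d-cut≤ u∈S)
        where
        S⊆cut : S ⊆ cut u∈S
        S⊆cut {v} v∈S with v ≟ u
        ... | yes refl = u∈cut
        ... | no v≢u   = ∈cut u∈S v∈S v≢u

      -- The complement of `X` lies between the cut and `U`: it is either a rival for `S - u` or `U`
      -- itself.
      d-cut-min : ∀ {u} (u∈S : u ∈ S) X → ∁ U ⊆ X → X ⊆ ∁ (cut u∈S) → d G (∁ (cut u∈S)) ≤ d G X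
      d-cut-min {u} u∈S X ∁U⊆X X⊆A =
        ≤-trans (d-∁-≤ G (cut u∈S)) (≤-trans d-cut≤d-∁X (d-∁-≤ G X))
        where
        cut⊆∁X : cut u∈S ⊆ ∁ X
        cut⊆∁X v∈cut = x∉p⇒x∈∁p λ v∈X → x∈∁p⇒x∉p (X⊆A v∈X) v∈cut

        ∁X⊆U : ∁ X ⊆ U
        ∁X⊆U v∈∁X = x∉∁p⇒x∈p (x∈∁p⇒x∉p v∈∁X ∘ ∁U⊆X)

        d-cut≤d-∁X : d G (cut u∈S) ≤ d G (∁ X)
        d-cut≤d-∁X with U ⊆? ∁ X
        ... | yes U⊆∁X = subst (λ B → d G (cut u∈S) ≤ d G B) (⊆-antisym U⊆∁X ∁X⊆U) (d-cut≤ u∈S)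
        ... | no  U⊈∁X = let _ , (S-u⊆cut , u₀∈cut , _) , cut-min = best u∈S in
          cut-min (∁ X) ((λ v∈ → cut⊆∁X (S-u⊆cut v∈)) , cut⊆∁X u₀∈cut , ∁X⊆U , U⊈∁X)

    critical⇒cheap : 1 ≤ K → K + K ≤ ∣ S ∣ → CheapPartition G U u₀ K
    critical⇒cheap {K} 1≤K 2K≤∣S∣ = cheapPartition G U u₀ 1≤K (λ i → ∁ (cut (s∈S i))) s
      (λ i v∈∁U → x∉p⇒x∈∁p λ v∈cut → x∈∁p⇒x∉p v∈∁U (proj₁ (proj₂ (proj₂ (rival i))) v∈cut))
      (λ i → x∈p⇒x∉∁p (proj₁ (proj₂ (rival i))))
      (λ i → x∉p⇒x∈∁p (∉cut (s∈S i)))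
      (λ {i} {j} i≢j → x∈p⇒x∉∁p (∈cut (s∈S j) (s∈S i) (i≢j ∘ s-injective)))
      (λ i → ≤-trans (d-∁-≤ G _) (d-cut≤ (s∈S i)))
      (λ i → d-cut-min (s∈S i))
      where
      s : Fin (K + K) → Fin n
      s i = enumerate S (inject≤ i 2K≤∣S∣)

      s∈S : ∀ i → s i ∈ S
      s∈S i = enumerate-∈ S (inject≤ i 2K≤∣S∣)

      s-injective : ∀ {i j} → s i ≡ s j → i ≡ j
      s-injective {i} {j} eq = inject≤-injective 2K≤∣S∣ 2K≤∣S∣ i j (enumerate-injective S eq)

      rival : ∀ i → Rival (S - s i) (cut (s∈S i))
      rival i = proj₁ (proj₂ (best (s∈S i)))

  module _ (K : ℕ) (1≤K : 1 ≤ K) (¬cheap : ¬ CheapPartition G U u₀ K) where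

    -- Vertices are removed while `S` is too large and stays unbeaten. A stuck `S` has at least `2K`
    -- vertices, each critical, which would give a cheap partition.
    shrink : ∀ S → Acc _⊂_ S → S ⊆ U - u₀ → ¬ Beaten S →
             ∃[ S′ ] (S′ ⊆ U - u₀ × ∣ S′ ∣ ≤ K + K ∸ 1 × ¬ Beaten S′)
    shrink S (acc rec) S⊆ unbeaten with ∣ S ∣ ≤? K + K ∸ 1
    ... | yes small = S , S⊆ , small , unbeaten
    ... | no  large with any? (λ u → (u ∈? S) ×-dec ¬? (beaten? (S - u)))
    ...   | yes (u , u∈S , unbeaten′) =
      shrink (S - u) (rec (x∈p⇒p-x⊂p u∈S)) (λ v∈ → S⊆ (p─q⊆p S ⁅ u ⁆ v∈)) unbeaten′
    ...   | no none = contradiction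
      (critical⇒cheap S unbeaten
        (λ {u} u∈S → decidable-stable (beaten? (S - u)) λ unbeaten′ → none (u , u∈S , unbeaten′))
        1≤K (≤-trans (m≤n+m∸n (K + K) 1) (≰⇒> large)))
      ¬cheap

  unbeaten⇒uniqueMin : ∀ S → Is2Partition U → S ⊆ U → u₀ ∈ U → ¬ Beaten S →
                       IsUniqueMinTerminalCut G (S ∪ ⁅ u₀ ⁆) (∁ U) U
  unbeaten⇒uniqueMin S is2 S⊆U u₀∈U unbeaten =
    ((is2 , S∪u₀⊆U , λ v∈U → x∉p⇒x∈∁p (x∈p⇒x∉∁p v∈U)) , minimum) ,
    λ B (cutB , B-min) → cheap⇒≡ B cutB (B-min U (is2 , S∪u₀⊆U , λ v∈U → x∉p⇒x∈∁p (x∈p⇒x∉∁p v∈U)))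
    where
    S∪u₀⊆U : S ∪ ⁅ u₀ ⁆ ⊆ U
    S∪u₀⊆U v∈ with x∈p∪q⁻ S ⁅ u₀ ⁆ v∈
    ... | inj₁ v∈S = S⊆U v∈S
    ... | inj₂ v∈u₀ rewrite x∈⁅y⁆⇒x≡y u₀ v∈u₀ = u₀∈U

    cheap⇒≡ : ∀ B → IsTerminalCut (S ∪ ⁅ u₀ ⁆) (∁ U) B → d G B ≤ d G U → B ≡ U
    cheap⇒≡ B (_ , S∪u₀⊆B , B⊆∁∁U) dB≤dU = ⊆-antisym B⊆U (decidable-stable (U ⊆? B) λ U⊈B →
      unbeaten (B , ((λ v∈S → S∪u₀⊆B (x∈p∪q⁺ (inj₁ v∈S))) , S∪u₀⊆B (x∈p∪q⁺ (inj₂ (x∈⁅x⁆ u₀))) , B⊆U , U⊈B) , dB≤dU))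
      where
      B⊆U : B ⊆ U
      B⊆U v∈B = x∉∁p⇒x∈p (x∈∁p⇒x∉p (B⊆∁∁U v∈B))

    minimum : ∀ B → IsTerminalCut (S ∪ ⁅ u₀ ⁆) (∁ U) B → d G U ≤ d G B
    minimum B cutB with ≤-total (d G U) (d G B)
    ... | inj₁ dU≤dB = dU≤dB
    ... | inj₂ dB≤dU = ≤-reflexive (cong (d G) (sym (cheap⇒≡ B cutB dB≤dU)))

theorem5p2 : (n : ℕ) (G : Hypergraph n) (k : ℕ) → 2 ≤ k →
    (U : Subset n) → IsMinimalBalancedSplit G k U →
    (u₀ : Fin n) → u₀ ∈ U →
    ∃[ S ] (S ⊆ U - u₀ × ∣ S ∣ ≤ 2 * k ∸ 3 × IsUniqueMinTerminalCut G (S ∪ ⁅ u₀ ⁆) (∁ U) U)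
theorem5p2 n G (suc K) (s≤s 1≤K) U min@((is2 , _) , _) u₀ u₀∈U
  with shrink G U u₀ K 1≤K (minimalSplit⇒¬cheap G U u₀ 1≤K min u₀∈U)
         (U - u₀) (⊂-wellFounded (U - u₀)) (λ v∈ → v∈) whole-unbeaten
  where
  -- The removal starts from `U - u₀`, where a rival would have to contain all of `U`.
  whole-unbeaten : ¬ Beaten G U u₀ (U - u₀)
  whole-unbeaten (B , (U-u₀⊆B , u₀∈B , _ , U⊈B) , _) = U⊈B λ {v} v∈U → case v ≟ u₀ of λ where
    (yes refl) → u₀∈B
    (no v≢u₀)  → U-u₀⊆B (x∈p∧x≢y⇒x∈p-y v∈U v≢u₀)
... | S , S⊆ , small , unbeaten =
  -- For `k = suc K`, the bound `2 * k ∸ 3` is `K + K ∸ 1`.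
  S , S⊆ , subst (∣ S ∣ ≤_) (cong (_∸ 3) (sym (double K))) small ,
  unbeaten⇒uniqueMin G U u₀ S is2 (λ v∈ → p─q⊆p U ⁅ u₀ ⁆ (S⊆ v∈)) u₀∈U unbeaten
  where
  double : ∀ K → 2 * suc K ≡ 2 + (K + K)
  double = solve-∀
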